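{- For a nonnegative integer $n$, the number $b(n)$ of non-Rascoe partitions of $n$ is odd if and only if $n=m(5m+1)/2$ for some $m\in\mathbb{Z}$.
   Context: A non-Rascoe partition of a positive integer $n$ is a partition of $n$ into distinct parts in which the number of parts is not itself a part; the empty partition is counted as the unique non-Rascoe partition of $0$, so $b(0)=1$. -}

module Defs where

open import Data.Nat using (ℕ; zero; suc; _+_; _*_; _≡ᵇ_)
open import Data.Bool using (Bool; true; false; not; _∧_; if_then_else_)
open import Data.List using (List; []; _∷_; map; _++_; filterᵇ; length; concatMap)
open import Data.Vec using (Vec; []; _∷_)
open import Data.Fin using (Fin)
open import Data.Fin.Subset using (Subset; ∣_∣; _∈_)
open import Relation.Nullary using (¬_)
open import Relation.Nullary.Decidable using (⌊_⌋)
open import Data.Product using (_×_)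
open import Relation.Binary.PropositionalEquality using (_≡_)

-- A partition of n into distinct parts is determined by its set of parts,
-- a subset of {1,…,n}.  We encode it as  S : Subset n  (= Vec Bool n),
-- where position i : Fin n (i = 0,…,n-1) stands for the part i+1.

allSubsets : (n : ℕ) → List (Subset n)
allSubsets zero = [] ∷ []
allSubsets (suc n) =
  map (true ∷_) (allSubsets n) ++ map (false ∷_) (allSubsets n)

partSumFrom : ∀ {m} → ℕ → Vec Bool m → ℕ
partSumFrom k [] = 0
partSumFrom k (true ∷ s) = suc k + partSumFrom (suc k) s
partSumFrom k (false ∷ s) = partSumFrom (suc k) s

partSum : ∀ {m} → Subset m → ℕ
partSum = partSumFrom 0

hasPart : ∀ {m} → ℕ → Vec Bool m → Bool
hasPart p [] = false
hasPart zero (b ∷ s) = false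
hasPart (suc zero) (b ∷ s) = b
hasPart (suc (suc p)) (b ∷ s) = hasPart (suc p) s

IsDistinctPartition : (n : ℕ) → Subset n → Bool
IsDistinctPartition n S = partSum S ≡ᵇ n

-- non-Rascoe: the number of parts ∣ S ∣ is not itself a part
-- (for the empty partition of 0 the number of parts is 0, never a part)
IsNonRascoe : (n : ℕ) → Subset n → Bool
IsNonRascoe n S = IsDistinctPartition n S ∧ not (hasPart ∣ S ∣ S)

b : ℕ → ℕ
b n = length (filterᵇ (IsNonRascoe n) (allSubsets n))

{-# OPTIONS --safe #-}

-- Work with power series over 𝔽₂. Let B(a) be the sum of q^(∑S + a∣S∣) over the
-- sets S of parts that do not contain a + ∣S∣. Removing the part a + ∣S∣ from
-- the other sets gives B(a) = ∏_{i>a} (1 + q^i) + q^(2a+1) B(a+1), so that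
--   ∑ b(n) q^n = B(0) = ∑_m q^(m²) ∏_{i>m} (1 + q^i).
-- This is the sum side of the first Rogers–Ramanujan identity times (q;q)_∞,
-- reduced mod 2. As in Rogers' proof, F(a) = ∑_m q^(m²+am) ∏_{i>m} (1 + q^i) and
--   R(a) = ∑_n q^(2an + n(5n−1)/2) (1 + q^(a+2n)) ∏_{n<i<n+a} (1 + q^i)
-- both satisfy X(a) = X(a+1) + q^(a+1) X(a+2) and agree modulo q^(a+1), hence
-- F(0) = R(0) = 1 + ∑_{n≥1} q^(n(5n−1)/2) (1 + q^n).
module Submission where

open import Defs
open import Data.Bool using (Bool; true; false; not; _∧_; _xor_)
open import Data.Bool.Properties
  using (xor-same; xor-assoc; xor-comm; xor-identityʳ; not-involutive; ¬-not; ∧-zeroʳ; ∧-comm)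
open import Data.Bool.Solver using (module xor-∧-Solver)
open import Data.Empty using (⊥-elim)
open import Data.Fin.Subset using (Subset; ∣_∣)
open import Data.Integer as ℤ using (+_; -[1+_])
import Data.Integer.Properties as ℤ
import Data.Integer.Tactic.RingSolver as ℤ
open import Data.List using ([]; _∷_; map; _++_; filterᵇ; length)
open import Data.Nat using (ℕ; zero; suc; _+_; _*_; _≤_; _<_; z≤n; s≤s; pred; _≡ᵇ_; _%_)
open import Data.Nat.Properties
open import Data.Nat.Tactic.RingSolver using (solve-∀)
open import Data.Product using (_,_; ∃-syntax)
open import Data.Sum using (_⊎_; inj₁; inj₂)
open import Data.Vec using (Vec; []; _∷_)
open import Function.Base using (_∘_)
open import Function.Bundles using (_⇔_; mk⇔; module Equivalence)
open import Relation.Binary.PropositionalEquality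
open ≡-Reasoning

-- Formal power series over 𝔽₂ and multiplication by powers of q

Series : Set
Series = ℕ → Bool

infixl 6 _⊕_
infixr 7 _▹_

_⊕_ : Series → Series → Series
(f ⊕ g) N = f N xor g N

𝟘 𝟙 : Series
𝟘 _ = false
𝟙 zero    = true
𝟙 (suc _) = false

-- k ▹ f is q^k f.
_▹_ : ℕ → Series → Series
(zero  ▹ f) N       = f N
(suc k ▹ f) zero    = false
(suc k ▹ f) (suc N) = (k ▹ f) N

▹-𝟘 : ∀ k N → (k ▹ 𝟘) N ≡ false
▹-𝟘 zero    N       = refl
▹-𝟘 (suc k) zero    = refl
▹-𝟘 (suc k) (suc N) = ▹-𝟘 k N

▹-⊕ : ∀ k f g N → (k ▹ (f ⊕ g)) N ≡ (k ▹ f ⊕ k ▹ g) N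
▹-⊕ zero    f g N       = refl
▹-⊕ (suc k) f g zero    = refl
▹-⊕ (suc k) f g (suc N) = ▹-⊕ k f g N

▹-▹ : ∀ j k f N → (j ▹ k ▹ f) N ≡ ((j + k) ▹ f) N
▹-▹ zero    k f N       = refl
▹-▹ (suc j) k f zero    = refl
▹-▹ (suc j) k f (suc N) = ▹-▹ j k f N

-- The coefficient of q^N in q^k f only sees f up to degree N - k. This lets identities that hold
-- only modulo q^(L+1) be used under a shift.
▹-cong≤ : ∀ k {f g} N → (∀ M → k + M ≤ N → f M ≡ g M) → (k ▹ f) N ≡ (k ▹ g) N
▹-cong≤ zero    N       eq = eq N ≤-refl
▹-cong≤ (suc k) zero    eq = refl
▹-cong≤ (suc k) (suc N) eq = ▹-cong≤ k N λ M le → eq M (s≤s le)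

▹-cong : ∀ k {f g} → f ≗ g → k ▹ f ≗ k ▹ g
▹-cong k eq N = ▹-cong≤ k N λ M _ → eq M

▹-exp : ∀ {j k} f N → j ≡ k → (j ▹ f) N ≡ (k ▹ f) N
▹-exp f N = cong λ i → (i ▹ f) N

▹-vanish : ∀ {k} f {N} → N < k → (k ▹ f) N ≡ false
▹-vanish {suc k} f {zero}  lt       = refl
▹-vanish {suc k} f {suc N} (s≤s lt) = ▹-vanish f lt

-- Finite sums and products modulo 2

∑< : ℕ → (ℕ → Bool) → Bool
∑< zero    t = false
∑< (suc M) t = t 0 xor ∑< M (λ n → t (suc n))

∑ : ℕ → (ℕ → Series) → Series
∑ M t N = ∑< M (λ n → t n N)

xor-interchange : ∀ a b c d → (a xor b) xor (c xor d) ≡ (a xor c) xor (b xor d)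
xor-interchange = solve 4 (λ a b c d → (a :+ b) :+ (c :+ d) := (a :+ c) :+ (b :+ d)) refl
  where open xor-∧-Solver

∑<-cong : ∀ M {s t : ℕ → Bool} → (∀ n → n < M → s n ≡ t n) → ∑< M s ≡ ∑< M t
∑<-cong zero    eq = refl
∑<-cong (suc M) eq = cong₂ _xor_ (eq 0 (s≤s z≤n)) (∑<-cong M λ n lt → eq (suc n) (s≤s lt))

∑<-false : ∀ M {t : ℕ → Bool} → (∀ n → t n ≡ false) → ∑< M t ≡ false
∑<-false zero    eq = refl
∑<-false (suc M) eq = cong₂ _xor_ (eq 0) (∑<-false M λ n → eq (suc n))

∑<-xor : ∀ M s t → ∑< M (λ n → s n xor t n) ≡ ∑< M s xor ∑< M t
∑<-xor zero    s t = refl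
∑<-xor (suc M) s t = trans (cong ((s 0 xor t 0) xor_) (∑<-xor M _ _))
  (xor-interchange (s 0) (t 0) (∑< M (λ n → s (suc n))) (∑< M (λ n → t (suc n))))

∑<-last : ∀ M t → ∑< (suc M) t ≡ ∑< M t xor t M
∑<-last zero    t = xor-identityʳ (t 0)
∑<-last (suc M) t = trans (cong (t 0 xor_) (∑<-last M _)) (sym (xor-assoc (t 0) _ _))

∑<-telescope : ∀ M v → ∑< M (λ n → v n xor v (suc n)) ≡ v 0 xor v M
∑<-telescope zero    v = sym (xor-same (v 0))
∑<-telescope (suc M) v = begin
  (v 0 xor v 1) xor ∑< M (λ n → v (suc n) xor v (suc (suc n)))
    ≡⟨ cong ((v 0 xor v 1) xor_) (∑<-telescope M (λ n → v (suc n))) ⟩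
  (v 0 xor v 1) xor (v 1 xor v (suc M))
    ≡⟨ solve 3 (λ a b c → (a :+ b) :+ (b :+ c) := a :+ c) refl (v 0) (v 1) (v (suc M)) ⟩
  v 0 xor v (suc M) ∎
  where open xor-∧-Solver

▹-∑ : ∀ k M t N → (k ▹ ∑ M t) N ≡ ∑ M (λ n → k ▹ t n) N
▹-∑ k zero    t N = ▹-𝟘 k N
▹-∑ k (suc M) t N = trans (▹-⊕ k (t 0) (∑ M (λ n → t (suc n))) N)
  (cong ((k ▹ t 0) N xor_) (▹-∑ k M _ N))

-- ∏ k m is (1 + q^(k+1)) ⋯ (1 + q^(k+m)).
∏ : ℕ → ℕ → Series
∏ k zero    = 𝟙
∏ k (suc m) = ∏ (suc k) m ⊕ suc k ▹ ∏ (suc k) m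

-- The recursion of `∏` splits off the factor of lowest degree. Splitting off the highest one
-- instead is an induction in which the two shifts have to commute.
∏-last : ∀ k m → ∏ k (suc m) ≗ ∏ k m ⊕ suc (k + m) ▹ ∏ k m
∏-last k zero N = cong (𝟙 N xor_) (▹-exp 𝟙 N (cong suc (sym (+-identityʳ k))))
∏-last k (suc m) N = begin
  P N xor (suc k ▹ P) N
    ≡⟨ cong₂ _xor_ (∏-last (suc k) m N) (▹-cong (suc k) (∏-last (suc k) m) N) ⟩
  (Q N xor (j ▹ Q) N) xor (suc k ▹ (Q ⊕ j ▹ Q)) N
    ≡⟨ cong₂ (λ x y → (Q N xor x) xor y) (▹-exp Q N j≡i) (▹-⊕ (suc k) Q (j ▹ Q) N) ⟩
  (Q N xor (i ▹ Q) N) xor ((suc k ▹ Q) N xor (suc k ▹ j ▹ Q) N)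
    ≡⟨ cong (λ x → (Q N xor (i ▹ Q) N) xor ((suc k ▹ Q) N xor x)) commute ⟩
  (Q N xor (i ▹ Q) N) xor ((suc k ▹ Q) N xor (i ▹ suc k ▹ Q) N)
    ≡⟨ xor-interchange (Q N) ((i ▹ Q) N) ((suc k ▹ Q) N) ((i ▹ suc k ▹ Q) N) ⟩
  (Q N xor (suc k ▹ Q) N) xor ((i ▹ Q) N xor (i ▹ suc k ▹ Q) N)
    ≡⟨ cong ((Q N xor (suc k ▹ Q) N) xor_) (▹-⊕ i Q (suc k ▹ Q) N) ⟨
  (Q N xor (suc k ▹ Q) N) xor (i ▹ (Q ⊕ suc k ▹ Q)) N ∎
  where
  P = ∏ (suc k) (suc m)
  Q = ∏ (suc k) m
  i = suc (k + suc m)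
  j = suc (suc k + m)
  j≡i : j ≡ i
  j≡i = cong suc (sym (+-suc k m))
  commute : (suc k ▹ j ▹ Q) N ≡ (i ▹ suc k ▹ Q) N
  commute = trans (▹-▹ (suc k) j Q N)
    (trans (▹-exp Q N (trans (+-comm (suc k) j) (cong (_+ suc k) j≡i)))
      (sym (▹-▹ i (suc k) Q N)))

-- Each extra factor 1 + q^i has i > k + m ≥ N, so it cannot affect the coefficient of q^N.
∏-stable : ∀ {k m m′ N} → m ≤ m′ → N ≤ k + m → ∏ k m′ N ≡ ∏ k m N
∏-stable {k} {m} {m′} {N} m≤m′ N≤k+m with m≤n⇒m<n∨m≡n m≤m′
... | inj₂ refl = refl
∏-stable {k} {m} {suc m′} {N} m≤m′ N≤k+m | inj₁ (s≤s m≤m″) = begin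
  ∏ k (suc m′) N
    ≡⟨ ∏-last k m′ N ⟩
  ∏ k m′ N xor (suc (k + m′) ▹ ∏ k m′) N
    ≡⟨ cong (∏ k m′ N xor_) (▹-vanish (∏ k m′) (s≤s (≤-trans N≤k+m (+-monoʳ-≤ k m≤m″)))) ⟩
  ∏ k m′ N xor false
    ≡⟨ xor-identityʳ _ ⟩
  ∏ k m′ N
    ≡⟨ ∏-stable m≤m″ N≤k+m ⟩
  ∏ k m N ∎

-- The recurrence is G(x) = G(xq) + xq G(xq²) at x = q^a, read modulo q^(L+1).
recurrence-unique : ∀ {L} {X Y : ℕ → Series} →
  (∀ a N → N ≤ L → X a N ≡ (X (suc a) ⊕ suc a ▹ X (suc (suc a))) N) →
  (∀ a N → N ≤ L → Y a N ≡ (Y (suc a) ⊕ suc a ▹ Y (suc (suc a))) N) →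
  (∀ a N → N ≤ L → N ≤ a → X a N ≡ Y a N) →
  ∀ d a N → N ≤ L → N ≤ d + a → X a N ≡ Y a N
recurrence-unique recX recY base zero a N N≤L N≤a = base a N N≤L N≤a
recurrence-unique {L} {X} {Y} recX recY base (suc d) a N N≤L N≤d+a = begin
  X a N
    ≡⟨ recX a N N≤L ⟩
  X (suc a) N xor (suc a ▹ X (suc (suc a))) N
    -- The index `a` rises while the degree does not, so the gap `d` between them shrinks. In the
    -- second summand the shift by a + 1 already forces M ≤ d.
    ≡⟨ cong₂ _xor_ (ih (suc a) N N≤L (subst (N ≤_) (sym (+-suc d a)) N≤d+a))
         (▹-cong≤ (suc a) N λ M le → ih (suc (suc a)) M (≤-trans (M≤N le) N≤L) (bound M le)) ⟩
  Y (suc a) N xor (suc a ▹ Y (suc (suc a))) N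
    ≡⟨ recY a N N≤L ⟨
  Y a N ∎
  where
  ih = recurrence-unique {L} {X} {Y} recX recY base d
  M≤N : ∀ {M} → suc a + M ≤ N → M ≤ N
  M≤N {M} = ≤-trans (m≤n+m M (suc a))
  bound : ∀ M → suc a + M ≤ N → M ≤ d + suc (suc a)
  bound M le = ≤-trans (+-cancelˡ-≤ (suc a) M d (≤-trans le (≤-trans N≤d+a (≤-reflexive (swap d a)))))
                       (m≤m+n d (suc (suc a)))
    where
    swap : ∀ d a → suc (d + a) ≡ suc a + d
    swap = solve-∀

-- The two sides of the Rogers–Ramanujan identity

xor-transpose : ∀ x y {z} → x xor y ≡ z → x ≡ y xor z
xor-transpose x y eq = trans (solve 2 (λ x y → x := y :+ (x :+ y)) refl x y) (cong (y xor_) eq)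
  where open xor-∧-Solver

-- ∏ m L stands for the infinite product over i > m, with which it agrees modulo q^(L+1).
module SumSide (L : ℕ) where

  term : ℕ → ℕ → Series
  term a m = (m * m + a * m) ▹ ∏ m L

  F : ℕ → Series
  F a = ∑ (suc L) (term a)

  -- The second term carries an additional q^(m+1), so the sum contains the factor 1 + q^(m+1),
  -- which extends the product over i > m + 1 to the one over i > m. The exponents match by (m+1)² +
  -- a(m+1) = (a+1) + m² + (a+2)m.
  term-step : ∀ a m {N} → N ≤ L →
    term a (suc m) N xor term (suc a) (suc m) N ≡ (suc a ▹ term (suc (suc a)) m) N
  term-step a m {N} N≤L = begin
    (E ▹ P) N xor term (suc a) (suc m) N
      ≡⟨ cong ((E ▹ P) N xor_) (trans (▹-exp P N (exp₁ a m)) (sym (▹-▹ E (suc m) P N))) ⟩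
    (E ▹ P) N xor (E ▹ suc m ▹ P) N
      ≡⟨ ▹-⊕ E P (suc m ▹ P) N ⟨
    (E ▹ ∏ m (suc L)) N
      -- The surplus factor 1 + q^(m+L+1) lies beyond the precision L.
      ≡⟨ ▹-cong≤ E N (λ M le → ∏-stable (n≤1+n L)
           (≤-trans (m≤n+m M E) (≤-trans le (≤-trans N≤L (m≤n+m L m))))) ⟩
    (E ▹ ∏ m L) N
      ≡⟨ trans (▹-exp (∏ m L) N (exp₂ a m)) (sym (▹-▹ (suc a) _ (∏ m L) N)) ⟩
    (suc a ▹ term (suc (suc a)) m) N ∎
    where
    E = suc m * suc m + a * suc m
    P = ∏ (suc m) L
    exp₁ : ∀ a m → suc m * suc m + suc a * suc m ≡ suc m * suc m + a * suc m + suc m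
    exp₁ = solve-∀
    exp₂ : ∀ a m → suc m * suc m + a * suc m ≡ suc a + (m * m + suc (suc a) * m)
    exp₂ = solve-∀

  private
    L<last : ∀ a → L < suc a + (L * L + suc (suc a) * L)
    L<last a = s≤s (≤-trans (m≤n*m L (suc (suc a)))
      (≤-trans (m≤n+m (suc (suc a) * L) (L * L)) (m≤n+m _ a)))

  -- The terms with m = 0 cancel, and `term-step` shifts the remaining indices down by one. The
  -- shifted sum then lacks its term of index L, whose exponent exceeds L.
  F-rec : ∀ a N → N ≤ L → F a N ≡ (F (suc a) ⊕ suc a ▹ F (suc (suc a))) N
  F-rec a N N≤L = xor-transpose (F a N) (F (suc a) N) (begin
    F a N xor F (suc a) N
      ≡⟨ ∑<-xor (suc L) (λ m → term a m N) (λ m → term (suc a) m N) ⟨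
    (term a 0 N xor term (suc a) 0 N) xor ∑< L (λ m → term a (suc m) N xor term (suc a) (suc m) N)
      ≡⟨ cong₂ _xor_ zeroth (∑<-cong L λ m _ → term-step a m N≤L) ⟩
    ∑ L (λ m → suc a ▹ term (suc (suc a)) m) N
      ≡⟨ xor-identityʳ _ ⟨
    ∑ L (λ m → suc a ▹ term (suc (suc a)) m) N xor false
      ≡⟨ cong (∑ L (λ m → suc a ▹ term (suc (suc a)) m) N xor_) (sym last) ⟩
    ∑ L (λ m → suc a ▹ term (suc (suc a)) m) N xor (suc a ▹ term (suc (suc a)) L) N
      ≡⟨ ∑<-last L (λ m → (suc a ▹ term (suc (suc a)) m) N) ⟨
    ∑ (suc L) (λ m → suc a ▹ term (suc (suc a)) m) N
      ≡⟨ ▹-∑ (suc a) (suc L) (term (suc (suc a))) N ⟨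
    (suc a ▹ F (suc (suc a))) N ∎)
    where
    zeroth : term a 0 N xor term (suc a) 0 N ≡ false
    zeroth = trans (cong₂ _xor_ (▹-exp (∏ 0 L) N (*-zeroʳ a)) (▹-exp (∏ 0 L) N (*-zeroʳ a)))
      (xor-same (∏ 0 L N))
    last : (suc a ▹ term (suc (suc a)) L) N ≡ false
    last = trans (▹-▹ (suc a) _ (∏ L L) N) (▹-vanish (∏ L L) (≤-trans (s≤s N≤L) (L<last a)))

  -- Every term with m ≥ 1 has exponent at least a + 1.
  F-low : ∀ a N → N ≤ a → F a N ≡ ∏ 0 L N
  F-low a N N≤a = trans (cong₂ _xor_ (▹-exp (∏ 0 L) N (*-zeroʳ a))
      (∑<-false L λ m → ▹-vanish (∏ (suc m) L) (s≤s (≤-trans N≤a (high m)))))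
    (xor-identityʳ _)
    where
    high : ∀ m → a ≤ m + m * suc m + a * suc m
    high m = ≤-trans (m≤m*n a (suc m)) (m≤n+m (a * suc m) _)

-- pent n = n(5n − 1)/2
pent : ℕ → ℕ
pent zero    = 0
pent (suc n) = pent n + (5 * n + 2)

n≤pent : ∀ n → n ≤ pent n
n≤pent zero    = z≤n
n≤pent (suc n) = ≤-trans (≤-reflexive (+-comm 1 n))
  (+-mono-≤ (n≤pent n) (≤-trans (s≤s z≤n) (m≤n+m 2 (5 * n))))

-- ∏ (n − 1) a, killed at n = 0 where it contains the factor 1 + q⁰.
∏⁻ : ℕ → ℕ → Series
∏⁻ zero    a = 𝟘
∏⁻ (suc n) a = ∏ n a

-- The lowest factor 1 + q^n is split off. For n = 0 it is 1 + 1 = 0 in 𝔽₂, in agreement with the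
-- value 𝟘 of `∏⁻`.
∏⁻-last : ∀ n a → ∏⁻ n (suc a) ≗ ∏ n a ⊕ n ▹ ∏ n a
∏⁻-last zero    a N = sym (xor-same (∏ 0 a N))
∏⁻-last (suc n) a N = refl

-- The exponent 2an + n(5n - 1)/2 in the summand of R(a).
c : ℕ → ℕ → ℕ
c a n = 2 * a * n + pent n

-- The summand of R(a), with 1 + q^(a+2n) split as q^n (1 + q^(n+a)) + (1 + q^n)
-- so that it also makes sense at a = 0.
pterm : ℕ → ℕ → Series
pterm a n = c a n ▹ (n ▹ ∏ n a ⊕ ∏⁻ n a)

-- q^(a+1) R(a+2) = R(a) − R(a+1) holds termwise up to a telescoping difference of these.
remainder : ℕ → ℕ → Series
remainder a n = c a n ▹ (∏⁻ n a ⊕ n ▹ ∏⁻ n (suc a))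

▹-⊕-▹ : ∀ j k f g N → (j ▹ (k ▹ f ⊕ g)) N ≡ ((j + k) ▹ f) N xor (j ▹ g) N
▹-⊕-▹ j k f g N = trans (▹-⊕ j (k ▹ f) g N) (cong (_xor (j ▹ g) N) (▹-▹ j k f N))

-- From a + 1 on, a common factor `∏ n a` can be taken out. The cofactor q^n (1 + q^(n+a+1)) + (1 +
-- q^n) collapses to 1 + q^(a+1+2n), as in the closed form of R.
pterm-suc : ∀ a n N → pterm (suc a) n N ≡
  ((c a n + (n + n)) ▹ ∏ n a) N xor ((c a n + (n + n) + suc (a + (n + n))) ▹ ∏ n a) N
pterm-suc a n N = begin
  (C ▹ (n ▹ ∏ n (suc a) ⊕ ∏⁻ n (suc a))) N
    ≡⟨ ▹-cong C (λ M → cong₂ _xor_ (▹-cong n (∏-last n a) M) (∏⁻-last n a M)) N ⟩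
  (C ▹ (n ▹ (p ⊕ suc (n + a) ▹ p) ⊕ (p ⊕ n ▹ p))) N
    ≡⟨ ▹-cong C (λ M → trans
         (cong (_xor (p M xor (n ▹ p) M)) (trans (▹-⊕ n p (suc (n + a) ▹ p) M)
            (cong ((n ▹ p) M xor_) (▹-▹ n (suc (n + a)) p M))))
         (solve 3 (λ x y z → (x :+ y) :+ (z :+ x) := y :+ z) refl
            ((n ▹ p) M) (((n + suc (n + a)) ▹ p) M) (p M))) N ⟩
  (C ▹ ((n + suc (n + a)) ▹ p ⊕ p)) N
    ≡⟨ ▹-⊕-▹ C (n + suc (n + a)) p p N ⟩
  ((C + (n + suc (n + a))) ▹ p) N xor (C ▹ p) N
    ≡⟨ xor-comm (((C + (n + suc (n + a))) ▹ p) N) ((C ▹ p) N) ⟩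
  (C ▹ p) N xor ((C + (n + suc (n + a))) ▹ p) N
    ≡⟨ cong₂ _xor_ (▹-exp p N (exp₁ a n (pent n))) (▹-exp p N (exp₂ a n (pent n))) ⟩
  _ ∎
  where
  open xor-∧-Solver
  p = ∏ n a
  C = c (suc a) n
  exp₁ : ∀ a n e → 2 * suc a * n + e ≡ 2 * a * n + e + (n + n)
  exp₁ = solve-∀
  exp₂ : ∀ a n e → 2 * suc a * n + e + (n + suc (n + a)) ≡ 2 * a * n + e + (n + n) + suc (a + (n + n))
  exp₂ = solve-∀

-- All three summands are expanded into shifts of `∏ n a`, `∏⁻ n a` and `∏ n (suc a)`. One shift
-- occurs twice and cancels; the other five make up the two remainders.
pterm-telescope : ∀ a n N →
  (pterm a n N xor pterm (suc a) n N) xor (suc a ▹ pterm (suc (suc a)) n) N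
    ≡ remainder a n N xor remainder a (suc n) N
pterm-telescope a n N = begin
  (pterm a n N xor pterm (suc a) n N) xor (suc a ▹ pterm (suc (suc a)) n) N
    ≡⟨ cong₂ (λ x y → (x xor pterm (suc a) n N) xor y) (▹-⊕-▹ C n p w N) second ⟩
  ((x₁ xor x₂) xor pterm (suc a) n N) xor ((x₅ xor x₆) xor x₇)
    ≡⟨ cong (λ y → ((x₁ xor x₂) xor y) xor ((x₅ xor x₆) xor x₇)) (pterm-suc a n N) ⟩
  ((x₁ xor x₂) xor (x₃ xor x₄)) xor ((x₅ xor x₆) xor x₇)
    -- The exponents of `x₄` and `x₅` agree, so this is the pair that cancels.
    ≡⟨ cong (λ y → ((x₁ xor x₂) xor (x₃ xor y)) xor ((x₅ xor x₆) xor x₇))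
         (▹-exp p N (exp₄ a n (pent n))) ⟩
  ((x₁ xor x₂) xor (x₃ xor x₅)) xor ((x₅ xor x₆) xor x₇)
    ≡⟨ solve 6 (λ x₁ x₂ x₃ x₅ x₆ x₇ →
         ((x₁ :+ x₂) :+ (x₃ :+ x₅)) :+ ((x₅ :+ x₆) :+ x₇)
           := (x₂ :+ (x₁ :+ x₃)) :+ (x₇ :+ x₆)) refl x₁ x₂ x₃ x₅ x₆ x₇ ⟩
  (x₂ xor (x₁ xor x₃)) xor (x₇ xor x₆)
    ≡⟨ cong₂ _xor_ first last ⟨
  remainder a n N xor remainder a (suc n) N ∎
  where
  open xor-∧-Solver
  C = c a n
  p = ∏ n a
  p′ = ∏ n (suc a)
  w = ∏⁻ n a
  D = suc a + (c (suc a) n + (n + n))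
  G = suc (n + a)
  x₁ = ((C + n) ▹ p) N
  x₂ = (C ▹ w) N
  x₃ = ((C + (n + n)) ▹ p) N
  x₄ = ((C + (n + n) + suc (a + (n + n))) ▹ p) N
  x₅ = (D ▹ p) N
  x₆ = ((D + G) ▹ p) N
  x₇ = ((D + suc (suc a + (n + n))) ▹ p′) N
  exp₄ : ∀ a n e → 2 * a * n + e + (n + n) + suc (a + (n + n)) ≡ suc a + (2 * suc a * n + e + (n + n))
  exp₄ = solve-∀
  exp₆ : ∀ a n e → 2 * a * suc n + (e + (5 * n + 2)) ≡ suc a + (2 * suc a * n + e + (n + n)) + suc (n + a)
  exp₆ = solve-∀
  exp₇ : ∀ a n e → 2 * a * suc n + (e + (5 * n + 2)) + suc n
    ≡ suc a + (2 * suc a * n + e + (n + n)) + suc (suc a + (n + n))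
  exp₇ = solve-∀
  second : (suc a ▹ pterm (suc (suc a)) n) N ≡ (x₅ xor x₆) xor x₇
  second = begin
    (suc a ▹ pterm (suc (suc a)) n) N
      ≡⟨ ▹-cong (suc a) (pterm-suc (suc a) n) N ⟩
    (suc a ▹ ((D₀ ▹ p′) ⊕ (D₀ + H) ▹ p′)) N
      ≡⟨ ▹-⊕ (suc a) (D₀ ▹ p′) ((D₀ + H) ▹ p′) N ⟩
    (suc a ▹ D₀ ▹ p′) N xor (suc a ▹ (D₀ + H) ▹ p′) N
      ≡⟨ cong₂ _xor_ (▹-▹ (suc a) D₀ p′ N)
           (trans (▹-▹ (suc a) (D₀ + H) p′ N) (▹-exp p′ N (sym (+-assoc (suc a) D₀ H)))) ⟩
    (D ▹ p′) N xor x₇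
      -- Only one copy of `p′` is expanded; the copy in `x₇` is needed intact, since
      -- `∏⁻ (suc n) (suc a)` in the next remainder is `p′`.
      ≡⟨ cong (_xor x₇) (trans (▹-cong D (∏-last n a) N) (▹-⊕ D p (G ▹ p) N)) ⟩
    (x₅ xor (D ▹ G ▹ p) N) xor x₇
      ≡⟨ cong (λ y → (x₅ xor y) xor x₇) (▹-▹ D G p N) ⟩
    (x₅ xor x₆) xor x₇ ∎
    where
    D₀ = c (suc a) n + (n + n)
    H = suc (suc a + (n + n))
  first : remainder a n N ≡ x₂ xor (x₁ xor x₃)
  first = begin
    (C ▹ (w ⊕ n ▹ ∏⁻ n (suc a))) N
      ≡⟨ ▹-⊕ C w (n ▹ ∏⁻ n (suc a)) N ⟩
    x₂ xor (C ▹ n ▹ ∏⁻ n (suc a)) N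
      ≡⟨ cong (x₂ xor_) (▹-▹ C n (∏⁻ n (suc a)) N) ⟩
    x₂ xor ((C + n) ▹ ∏⁻ n (suc a)) N
      ≡⟨ cong (x₂ xor_) (trans (▹-cong (C + n) (∏⁻-last n a) N) (▹-⊕ (C + n) p (n ▹ p) N)) ⟩
    x₂ xor (x₁ xor ((C + n) ▹ n ▹ p) N)
      ≡⟨ cong (λ y → x₂ xor (x₁ xor y)) (trans (▹-▹ (C + n) n p N) (▹-exp p N (+-assoc C n n))) ⟩
    x₂ xor (x₁ xor x₃) ∎
  last : remainder a (suc n) N ≡ x₇ xor x₆
  last = begin
    (c a (suc n) ▹ (p ⊕ suc n ▹ p′)) N
      ≡⟨ ▹-⊕ (c a (suc n)) p (suc n ▹ p′) N ⟩
    (c a (suc n) ▹ p) N xor (c a (suc n) ▹ suc n ▹ p′) N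
      ≡⟨ xor-comm ((c a (suc n) ▹ p) N) _ ⟩
    (c a (suc n) ▹ suc n ▹ p′) N xor (c a (suc n) ▹ p) N
      ≡⟨ cong₂ _xor_ (trans (▹-▹ (c a (suc n)) (suc n) p′ N) (▹-exp p′ N (exp₇ a n (pent n))))
           (▹-exp p N (exp₆ a n (pent n))) ⟩
    x₇ xor x₆ ∎

module PentagonalSide (L : ℕ) where

  R : ℕ → Series
  R a = ∑ (suc L) (pterm a)

  R-rec : ∀ a N → N ≤ L → R a N ≡ (R (suc a) ⊕ suc a ▹ R (suc (suc a))) N
  R-rec a N N≤L = trans (xor-transpose (R a N) _ (begin
    R a N xor (R (suc a) N xor (suc a ▹ R (suc (suc a))) N)
      ≡⟨ xor-assoc (R a N) (R (suc a) N) _ ⟨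
    (R a N xor R (suc a) N) xor (suc a ▹ R (suc (suc a))) N
      ≡⟨ cong₂ _xor_ (sym (∑<-xor (suc L) (λ n → pterm a n N) (λ n → pterm (suc a) n N)))
           (▹-∑ (suc a) (suc L) (pterm (suc (suc a))) N) ⟩
    ∑< (suc L) (λ n → pterm a n N xor pterm (suc a) n N) xor ∑< (suc L) (λ n → (suc a ▹ pterm (suc (suc a)) n) N)
      ≡⟨ ∑<-xor (suc L) (λ n → pterm a n N xor pterm (suc a) n N)
           (λ n → (suc a ▹ pterm (suc (suc a)) n) N) ⟨
    ∑< (suc L) (λ n → (pterm a n N xor pterm (suc a) n N) xor (suc a ▹ pterm (suc (suc a)) n) N)
      ≡⟨ ∑<-cong (suc L) (λ n _ → pterm-telescope a n N) ⟩
    ∑< (suc L) (λ n → remainder a n N xor remainder a (suc n) N)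
      ≡⟨ ∑<-telescope (suc L) (λ n → remainder a n N) ⟩
    remainder a 0 N xor remainder a (suc L) N
      -- At index 0 both products in the remainder are 𝟘; at index L + 1 the exponent is already
      -- greater than N.
      ≡⟨ cong₂ _xor_ (▹-𝟘 (c a 0) N) (▹-vanish {c a (suc L)} _ large) ⟩
    false ∎)) (xor-identityʳ _)
    where
    large : N < c a (suc L)
    large = ≤-trans (s≤s N≤L) (≤-trans (n≤pent (suc L)) (m≤n+m (pent (suc L)) (2 * a * suc L)))

  -- Every summand with n ≥ 1 has exponent at least a + 1, and the one with n = 0 is the bare
  -- product.
  R-low : ∀ a N → N ≤ a → R a N ≡ ∏ 0 a N
  R-low a N N≤a = begin
    pterm a 0 N xor ∑< L (λ n → pterm a (suc n) N)
      ≡⟨ cong₂ _xor_ zeroth (∑<-false L λ n → ▹-vanish {c a (suc n)} _ (high n)) ⟩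
    ∏ 0 a N xor false
      ≡⟨ xor-identityʳ _ ⟩
    ∏ 0 a N ∎
    where
    zeroth : pterm a 0 N ≡ ∏ 0 a N
    zeroth = trans (▹-exp (∏ 0 a ⊕ 𝟘) N (trans (+-identityʳ (2 * a * 0)) (*-zeroʳ (2 * a))))
      (xor-identityʳ _)
    high : ∀ n → N < c a (suc n)
    high n = ≤-trans (≤-reflexive (+-comm 1 N))
      (+-mono-≤ (≤-trans N≤a (≤-trans (m≤n*m a 2) (m≤m*n (2 * a) (suc n))))
                (≤-trans (s≤s z≤n) (n≤pent (suc n))))

sum≡pentagonal : ∀ L → SumSide.F L 0 L ≡ PentagonalSide.R L 0 L
sum≡pentagonal L = recurrence-unique {L} F-rec R-rec low L 0 L ≤-refl (m≤m+n L 0)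
  where
  open SumSide L
  open PentagonalSide L
  low : ∀ a N → N ≤ L → N ≤ a → F a N ≡ R a N
  low a N N≤L N≤a = begin
    F a N   ≡⟨ F-low a N N≤a ⟩
    ∏ 0 L N ≡⟨ ∏-stable N≤L ≤-refl ⟩
    ∏ 0 N N ≡⟨ ∏-stable N≤a ≤-refl ⟨
    ∏ 0 a N ≡⟨ R-low a N N≤a ⟨
    R a N   ∎

-- Coefficients of ∑ q^(m(5m+1)/2)

monomial⁻ : ∀ k N → (k ▹ 𝟙) N ≡ true → N ≡ k
monomial⁻ zero    zero    _  = refl
monomial⁻ (suc k) (suc N) eq = cong suc (monomial⁻ k N eq)

monomial⁺ : ∀ k → (k ▹ 𝟙) k ≡ true
monomial⁺ zero    = refl
monomial⁺ (suc k) = monomial⁺ k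

monomial-≢ : ∀ {k N} → N ≢ k → (k ▹ 𝟙) N ≡ false
monomial-≢ {k} {N} N≢k = ¬-not (N≢k ∘ monomial⁻ k N)

-- The two values are m(5m+1)/2 at m = -n and at m = n.
IsPent : ℕ → ℕ → Set
IsPent n N = N ≡ pent n ⊎ N ≡ pent n + n

-- At a = 0 both products are empty, which leaves two monomials.
pterm₀ : ∀ n N → pterm 0 (suc n) N ≡ ((pent (suc n) + suc n) ▹ 𝟙) N xor (pent (suc n) ▹ 𝟙) N
pterm₀ n N = ▹-⊕-▹ (pent (suc n)) (suc n) 𝟙 𝟙 N

pterm₀⁻ : ∀ n N → pterm 0 n N ≡ true → IsPent n N
pterm₀⁻ zero zero _ = inj₁ refl
pterm₀⁻ (suc n) N eq with (pent (suc n) ▹ 𝟙) N in eq′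
... | true  = inj₁ (monomial⁻ _ N eq′)
... | false = inj₂ (monomial⁻ _ N (begin
  ((pent (suc n) + suc n) ▹ 𝟙) N                             ≡⟨ xor-identityʳ _ ⟨
  ((pent (suc n) + suc n) ▹ 𝟙) N xor false                   ≡⟨ cong (((pent (suc n) + suc n) ▹ 𝟙) N xor_) eq′ ⟨
  ((pent (suc n) + suc n) ▹ 𝟙) N xor (pent (suc n) ▹ 𝟙) N    ≡⟨ pterm₀ n N ⟨
  pterm 0 (suc n) N                                          ≡⟨ eq ⟩
  true                                                       ∎))

-- For n ≥ 1 the two exponents differ, so the monomials do not cancel. For n = 0 they would
-- coincide, but there `∏⁻` removes one of them.
pterm₀⁺ : ∀ n N → IsPent n N → pterm 0 n N ≡ true
pterm₀⁺ zero N (inj₁ refl) = refl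
pterm₀⁺ zero N (inj₂ refl) = refl
pterm₀⁺ (suc n) N (inj₁ refl) = trans (pterm₀ n N)
  (cong₂ _xor_ (monomial-≢ λ eq → m≢1+m+n (pent (suc n)) (trans eq (+-suc _ n))) (monomial⁺ (pent (suc n))))
pterm₀⁺ (suc n) N (inj₂ refl) = trans (pterm₀ n N)
  (cong₂ _xor_ (monomial⁺ (pent (suc n) + suc n))
    (monomial-≢ λ eq → m≢1+m+n (pent (suc n)) (trans (sym eq) (+-suc _ n))))

pent-mono : ∀ {m n} → m ≤ n → pent m ≤ pent n
pent-mono {n = zero}  z≤n = z≤n
pent-mono {n = suc n} m≤1+n with m≤n⇒m<n∨m≡n m≤1+n
... | inj₁ (s≤s m≤n) = ≤-trans (pent-mono m≤n) (m≤m+n (pent n) _)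
... | inj₂ refl      = ≤-refl

IsPent-lower : ∀ n {N} → IsPent n N → pent n ≤ N
IsPent-lower n (inj₁ refl) = ≤-refl
IsPent-lower n (inj₂ refl) = m≤m+n (pent n) n

IsPent-upper : ∀ n {N} → IsPent n N → N < pent (suc n)
IsPent-upper n h = ≤-trans (s≤s (upper h))
  (≤-trans (≤-reflexive (sym (+-suc (pent n) n)))
    (+-monoʳ-≤ (pent n) (≤-trans (s≤s (m≤n*m n 5))
      (≤-trans (≤-reflexive (+-comm 1 (5 * n))) (+-monoʳ-≤ (5 * n) (s≤s z≤n))))))
  where
  upper : ∀ {N} → IsPent n N → N ≤ pent n + n
  upper (inj₁ refl) = m≤m+n (pent n) n
  upper (inj₂ refl) = ≤-refl

-- The intervals from `pent n` up to but excluding `pent (suc n)` are disjoint. By symmetry N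
-- determines n, so no two summands of R(0) cancel modulo 2.
IsPent-≤ : ∀ {m n N} → IsPent m N → IsPent n N → m ≤ n
IsPent-≤ {m} {n} hm hn with ≤-<-connex m n
... | inj₁ m≤n = m≤n
... | inj₂ n<m = ⊥-elim (<-irrefl refl
  (≤-trans (IsPent-upper n hn) (≤-trans (pent-mono n<m) (IsPent-lower m hm))))

∑<-true⁻ : ∀ M t → ∑< M t ≡ true → ∃[ n ] t n ≡ true
∑<-true⁻ (suc M) t eq with t 0 in eq₀
... | true  = 0 , eq₀
... | false with ∑<-true⁻ M (t ∘ suc) eq
...   | n , tn = suc n , tn

∑<-true⁺ : ∀ {M t n} → (∀ k → t k ≡ true → k ≡ n) → n < M → t n ≡ true → ∑< M t ≡ true
∑<-true⁺ {suc M} {t} {zero} unique _ tn = cong₂ _xor_ tn (∑<-false M λ k → ¬-not λ tk → 1+n≢0 (unique (suc k) tk))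
∑<-true⁺ {suc M} {t} {suc n} unique (s≤s n<M) tn =
  cong₂ _xor_ (¬-not λ t0 → 0≢1+n (unique 0 t0))
    (∑<-true⁺ {M} {t ∘ suc} (λ k tk → suc-injective (unique (suc k) tk)) n<M tn)

pentagonal-coeff : ∀ N → PentagonalSide.R N 0 N ≡ true ⇔ (∃[ n ] IsPent n N)
pentagonal-coeff N = mk⇔ to from
  where
  to : ∑< (suc N) (λ n → pterm 0 n N) ≡ true → ∃[ n ] IsPent n N
  to eq with ∑<-true⁻ (suc N) (λ n → pterm 0 n N) eq
  ... | n , tn = n , pterm₀⁻ n N tn
  from : (∃[ n ] IsPent n N) → ∑< (suc N) (λ n → pterm 0 n N) ≡ true
  from (n , h) = ∑<-true⁺ {t = λ n → pterm 0 n N}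
    (λ k tk → ≤-antisym (IsPent-≤ (pterm₀⁻ k N tk) h) (IsPent-≤ h (pterm₀⁻ k N tk)))
    -- The truncated sum reaches the index n because n ≤ `pent n` ≤ N.
    (s≤s (≤-trans (n≤pent n) (IsPent-lower n h))) (pterm₀⁺ n N h)

-- Comparison with m(5m+1)/2 for integers m

2pent+n : ∀ n → 2 * pent n + n ≡ 5 * n * n
2pent+n zero = refl
2pent+n (suc n) = begin
  2 * (pent n + (5 * n + 2)) + suc n ≡⟨ lemma₁ n (pent n) ⟩
  2 * pent n + n + (10 * n + 5)      ≡⟨ cong (_+ (10 * n + 5)) (2pent+n n) ⟩
  5 * n * n + (10 * n + 5)           ≡⟨ lemma₂ n ⟩
  5 * suc n * suc n                  ∎
  where
  lemma₁ : ∀ n e → 2 * (e + (5 * n + 2)) + suc n ≡ 2 * e + n + (10 * n + 5)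
  lemma₁ = solve-∀
  lemma₂ : ∀ n → 5 * n * n + (10 * n + 5) ≡ 5 * suc n * suc n
  lemma₂ = solve-∀

pos-5n² : ∀ n → + (5 * n * n) ≡ + 5 ℤ.* + n ℤ.* + n
pos-5n² n = trans (ℤ.pos-* (5 * n) n) (cong (ℤ._* + n) (ℤ.pos-* 5 n))

+pent : ∀ N n → N ≡ pent n + n ⇔ + 2 ℤ.* + N ≡ + n ℤ.* (+ 5 ℤ.* + n ℤ.+ + 1)
+pent N n = mk⇔ to from
  where
  rhs : + n ℤ.* (+ 5 ℤ.* + n ℤ.+ + 1) ≡ + (2 * (pent n + n))
  rhs = begin
    + n ℤ.* (+ 5 ℤ.* + n ℤ.+ + 1)  ≡⟨ expand (+ n) ⟩
    + 5 ℤ.* + n ℤ.* + n ℤ.+ + n    ≡⟨ cong (ℤ._+ + n) (pos-5n² n) ⟨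
    + (5 * n * n + n)              ≡⟨ cong (λ k → + (k + n)) (2pent+n n) ⟨
    + (2 * pent n + n + n)         ≡⟨ cong +_ (regroup (pent n) n) ⟩
    + (2 * (pent n + n))           ∎
    where
    expand : ∀ x → x ℤ.* (+ 5 ℤ.* x ℤ.+ + 1) ≡ + 5 ℤ.* x ℤ.* x ℤ.+ x
    expand = ℤ.solve-∀
    regroup : ∀ e n → 2 * e + n + n ≡ 2 * (e + n)
    regroup = solve-∀
  to : N ≡ pent n + n → + 2 ℤ.* + N ≡ + n ℤ.* (+ 5 ℤ.* + n ℤ.+ + 1)
  to refl = trans (sym (ℤ.pos-* 2 N)) (sym rhs)
  from : + 2 ℤ.* + N ≡ + n ℤ.* (+ 5 ℤ.* + n ℤ.+ + 1) → N ≡ pent n + n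
  from eq = *-cancelˡ-≡ N (pent n + n) 2 (ℤ.+-injective (trans (ℤ.pos-* 2 N) (trans eq rhs)))

-pent : ∀ N n → N ≡ pent n ⇔ + 2 ℤ.* + N ≡ ℤ.- (+ n) ℤ.* (+ 5 ℤ.* ℤ.- (+ n) ℤ.+ + 1)
-pent N n = mk⇔ to from
  where
  rhs : ℤ.- (+ n) ℤ.* (+ 5 ℤ.* ℤ.- (+ n) ℤ.+ + 1) ≡ + (2 * pent n)
  rhs = begin
    ℤ.- (+ n) ℤ.* (+ 5 ℤ.* ℤ.- (+ n) ℤ.+ + 1)  ≡⟨ expand (+ n) ⟩
    + 5 ℤ.* + n ℤ.* + n ℤ.+ ℤ.- (+ n)          ≡⟨ cong (ℤ._+ ℤ.- (+ n)) (pos-5n² n) ⟨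
    + (5 * n * n) ℤ.+ ℤ.- (+ n)                ≡⟨ cong (λ k → + k ℤ.+ ℤ.- (+ n)) (2pent+n n) ⟨
    + (2 * pent n) ℤ.+ + n ℤ.+ ℤ.- (+ n)       ≡⟨ cancel (+ (2 * pent n)) (+ n) ⟩
    + (2 * pent n)                             ∎
    where
    expand : ∀ x → ℤ.- x ℤ.* (+ 5 ℤ.* ℤ.- x ℤ.+ + 1) ≡ + 5 ℤ.* x ℤ.* x ℤ.+ ℤ.- x
    expand = ℤ.solve-∀
    cancel : ∀ x y → x ℤ.+ y ℤ.+ ℤ.- y ≡ x
    cancel = ℤ.solve-∀
  to : N ≡ pent n → + 2 ℤ.* + N ≡ ℤ.- (+ n) ℤ.* (+ 5 ℤ.* ℤ.- (+ n) ℤ.+ + 1)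
  to refl = trans (sym (ℤ.pos-* 2 N)) (sym rhs)
  from : + 2 ℤ.* + N ≡ ℤ.- (+ n) ℤ.* (+ 5 ℤ.* ℤ.- (+ n) ℤ.+ + 1) → N ≡ pent n
  from eq = *-cancelˡ-≡ N (pent n) 2 (ℤ.+-injective (trans (ℤ.pos-* 2 N) (trans eq rhs)))

IsPent⇔ : ∀ N → (∃[ n ] IsPent n N) ⇔ (∃[ m ] (+ 2 ℤ.* + N ≡ m ℤ.* (+ 5 ℤ.* m ℤ.+ + 1)))
IsPent⇔ N = mk⇔ to from
  where
  to : ∃[ n ] IsPent n N → ∃[ m ] (+ 2 ℤ.* + N ≡ m ℤ.* (+ 5 ℤ.* m ℤ.+ + 1))
  to (n , inj₁ eq) = ℤ.- (+ n) , Equivalence.to (-pent N n) eq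
  to (n , inj₂ eq) = + n , Equivalence.to (+pent N n) eq
  from : ∃[ m ] (+ 2 ℤ.* + N ≡ m ℤ.* (+ 5 ℤ.* m ℤ.+ + 1)) → ∃[ n ] IsPent n N
  -- The sign of m selects the larger or the smaller of the two values attached to n = |m|.
  from (+ n      , eq) = n , inj₂ (Equivalence.from (+pent N n) eq)
  from (-[1+ k ] , eq) = suc k , inj₁ (Equivalence.from (-pent N (suc k)) eq)

-- Non-Rascoe partitions

∑⊆ : ∀ m → (Subset m → Bool) → Bool
∑⊆ zero    φ = φ []
∑⊆ (suc m) φ = ∑⊆ m (φ ∘ (true ∷_)) xor ∑⊆ m (φ ∘ (false ∷_))

∑⊆-cong : ∀ m {φ ψ : Subset m → Bool} → φ ≗ ψ → ∑⊆ m φ ≡ ∑⊆ m ψ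
∑⊆-cong zero    eq = eq []
∑⊆-cong (suc m) eq = cong₂ _xor_ (∑⊆-cong m (eq ∘ (true ∷_))) (∑⊆-cong m (eq ∘ (false ∷_)))

∑⊆-xor : ∀ m φ ψ → ∑⊆ m (λ S → φ S xor ψ S) ≡ ∑⊆ m φ xor ∑⊆ m ψ
∑⊆-xor zero    φ ψ = refl
∑⊆-xor (suc m) φ ψ = trans (cong₂ _xor_ (∑⊆-xor m _ _) (∑⊆-xor m _ _))
  (xor-interchange (∑⊆ m (φ ∘ (true ∷_))) _ (∑⊆ m (φ ∘ (false ∷_))) _)

∑⊆-▹ : ∀ k m (t : Subset m → Series) N →
  (k ▹ (λ M → ∑⊆ m (λ S → t S M))) N ≡ ∑⊆ m (λ S → (k ▹ t S) N)
∑⊆-▹ k zero    t N = refl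
∑⊆-▹ k (suc m) t N = trans (▹-⊕ k (λ M → ∑⊆ m (λ S → t (true ∷ S) M)) _ N)
  (cong₂ _xor_ (∑⊆-▹ k m (t ∘ (true ∷_)) N) (∑⊆-▹ k m (t ∘ (false ∷_)) N))

-- Parity of a count as a sum over 𝔽₂

odd : ℕ → Bool
odd zero    = false
odd (suc n) = not (odd n)

odd-+ : ∀ m n → odd (m + n) ≡ odd m xor odd n
odd-+ zero    n = refl
odd-+ (suc m) n = trans (cong not (odd-+ m n)) (not-xor (odd m) (odd n))
  where
  not-xor : ∀ x y → not (x xor y) ≡ not x xor y
  not-xor true  y = not-involutive y
  not-xor false y = refl

odd⇔%2 : ∀ n → n % 2 ≡ 1 ⇔ odd n ≡ true
odd⇔%2 zero          = mk⇔ (λ ()) (λ ())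
odd⇔%2 (suc zero)    = mk⇔ (λ _ → refl) (λ _ → refl)
odd⇔%2 (suc (suc n)) = mk⇔ (λ eq → trans (not-involutive (odd n)) (to eq))
                           (λ eq → from (trans (sym (not-involutive (odd n))) eq))
  where open Equivalence (odd⇔%2 n)

module _ {A : Set} where
  length-filter-++ : ∀ (p : A → Bool) xs ys →
    length (filterᵇ p (xs ++ ys)) ≡ length (filterᵇ p xs) + length (filterᵇ p ys)
  length-filter-++ p []       ys = refl
  length-filter-++ p (x ∷ xs) ys with p x
  ... | true  = cong suc (length-filter-++ p xs ys)
  ... | false = length-filter-++ p xs ys

  length-filter-map : ∀ {B : Set} (p : A → Bool) (f : B → A) xs →
    length (filterᵇ p (map f xs)) ≡ length (filterᵇ (p ∘ f) xs)
  length-filter-map p f []       = refl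
  length-filter-map p f (x ∷ xs) with p (f x)
  ... | true  = cong suc (length-filter-map p f xs)
  ... | false = length-filter-map p f xs

odd-count : ∀ m (p : Subset m → Bool) → odd (length (filterᵇ p (allSubsets m))) ≡ ∑⊆ m p
odd-count zero p with p []
... | true  = refl
... | false = refl
odd-count (suc m) p = begin
  odd (length (filterᵇ p (map (true ∷_) (allSubsets m) ++ map (false ∷_) (allSubsets m))))
    ≡⟨ cong odd (length-filter-++ p (map (true ∷_) (allSubsets m)) _) ⟩
  odd (length (filterᵇ p (map (true ∷_) (allSubsets m))) + length (filterᵇ p (map (false ∷_) (allSubsets m))))
    ≡⟨ odd-+ (length (filterᵇ p (map (true ∷_) (allSubsets m)))) _ ⟩
  odd (length (filterᵇ p (map (true ∷_) (allSubsets m)))) xor odd (length (filterᵇ p (map (false ∷_) (allSubsets m))))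
    ≡⟨ cong₂ _xor_ (half true) (half false) ⟩
  ∑⊆ m (p ∘ (true ∷_)) xor ∑⊆ m (p ∘ (false ∷_)) ∎
  where
  half : ∀ x → odd (length (filterᵇ p (map (x ∷_) (allSubsets m)))) ≡ ∑⊆ m (p ∘ (x ∷_))
  half x = trans (cong odd (length-filter-map p (x ∷_) (allSubsets m))) (odd-count m (p ∘ (x ∷_)))

≡ᵇ-monomial : ∀ k N → (k ≡ᵇ N) ≡ (k ▹ 𝟙) N
≡ᵇ-monomial zero    zero    = refl
≡ᵇ-monomial zero    (suc N) = refl
≡ᵇ-monomial (suc k) zero    = refl
≡ᵇ-monomial (suc k) (suc N) = ≡ᵇ-monomial k N

-- Removing a part whose size depends on the number of parts

-- Tests that p is one of 1, ..., m and is missing, so that it could be inserted. Unlike the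
-- negation of `hasPart`, it is false for p outside this range.
hasGap : ∀ {m} → ℕ → Vec Bool m → Bool
hasGap p []      = false
hasGap p (x ∷ s) = ((p ≡ᵇ 1) ∧ not x) xor hasGap (pred p) s

hasPart-zero : ∀ {m} (s : Vec Bool m) → hasPart 0 s ≡ false
hasPart-zero []      = refl
hasPart-zero (x ∷ s) = refl

hasGap-zero : ∀ {m} (s : Vec Bool m) → hasGap 0 s ≡ false
hasGap-zero []      = refl
hasGap-zero (x ∷ s) = hasGap-zero s

-- Puts `hasPart` into the recursive form of `hasGap`, so that both sides of the bijection unfold
-- alike.
hasPart-∷ : ∀ {m} p x (s : Vec Bool m) → hasPart p (x ∷ s) ≡ ((p ≡ᵇ 1) ∧ x) xor hasPart (pred p) s
hasPart-∷ zero          x s = sym (hasPart-zero s)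
hasPart-∷ (suc zero)    x s = sym (trans (cong (x xor_) (hasPart-zero s)) (xor-identityʳ x))
hasPart-∷ (suc (suc p)) x s = refl

hasGap≡not-hasPart : ∀ {m} p → p < m → (s : Vec Bool m) → hasGap (suc p) s ≡ not (hasPart (suc p) s)
hasGap≡not-hasPart zero    _         (x ∷ s) = trans (cong (not x xor_) (hasGap-zero s)) (xor-identityʳ _)
hasGap≡not-hasPart (suc p) (s≤s p<m) (x ∷ s) = hasGap≡not-hasPart p p<m s

-- S ↦ S ∖ {f ∣S∣} as a bijection from the subsets that contain f ∣S∣.
remove-part : ∀ m k (f : ℕ → ℕ) (Φ : ℕ → ℕ → Bool) →
  ∑⊆ m (λ S → hasPart (f ∣ S ∣) S ∧ Φ ∣ S ∣ (partSumFrom k S)) ≡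
  ∑⊆ m (λ S → hasGap (f (suc ∣ S ∣)) S ∧ Φ (suc ∣ S ∣) (f (suc ∣ S ∣) + k + partSumFrom k S))
remove-part zero    k f Φ = refl
remove-part (suc m) k f Φ = begin
  ∑⊆ m (λ S → hasPart (f (suc ∣ S ∣)) (true ∷ S) ∧ Φ⁺ ∣ S ∣ (σ S)) xor
  ∑⊆ m (λ S → hasPart (f ∣ S ∣) (false ∷ S) ∧ Φ ∣ S ∣ (σ S))
    ≡⟨ cong₂ _xor_ (trans (∑⊆-cong m in-true) (∑⊆-xor m H _)) (∑⊆-cong m in-false) ⟩
  (∑⊆ m H xor ∑⊆ m (λ S → hasPart (g (suc ∣ S ∣)) S ∧ Φ⁺ ∣ S ∣ (σ S))) xor
  ∑⊆ m (λ S → hasPart (g ∣ S ∣) S ∧ Φ ∣ S ∣ (σ S))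
    ≡⟨ cong₂ (λ x y → (∑⊆ m H xor x) xor y)
         (remove-part m (suc k) (g ∘ suc) Φ⁺) (remove-part m (suc k) g Φ) ⟩
  (∑⊆ m H xor X) xor Y
    -- `H` collects the cases where the moved part is the first position: before removal they sit
    -- under `true ∷_`, afterwards under `false ∷_`.
    ≡⟨ solve 3 (λ j x y → (j :+ x) :+ y := x :+ (j :+ y)) refl (∑⊆ m H) X Y ⟩
  X xor (∑⊆ m H xor Y)
    ≡⟨ cong₂ _xor_ (∑⊆-cong m out-true) (trans (∑⊆-cong m out-false) (∑⊆-xor m H _)) ⟨
  ∑⊆ m (λ S → hasGap (f (suc (suc ∣ S ∣))) (true ∷ S)
          ∧ Φ (suc (suc ∣ S ∣)) (f (suc (suc ∣ S ∣)) + k + (suc k + σ S))) xor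
  ∑⊆ m (λ S → hasGap (f (suc ∣ S ∣)) (false ∷ S) ∧ Φ (suc ∣ S ∣) (f (suc ∣ S ∣) + k + σ S)) ∎
  where
  open xor-∧-Solver
  g : ℕ → ℕ
  g = pred ∘ f
  σ : Subset m → ℕ
  σ = partSumFrom (suc k)
  Φ⁺ : ℕ → ℕ → Bool
  Φ⁺ i w = Φ (suc i) (suc k + w)
  H : Subset m → Bool
  H S = (f (suc ∣ S ∣) ≡ᵇ 1) ∧ Φ⁺ ∣ S ∣ (σ S)
  X Y : Bool
  X = ∑⊆ m (λ S → hasGap (g (suc (suc ∣ S ∣))) S ∧ Φ⁺ (suc ∣ S ∣) (g (suc (suc ∣ S ∣)) + suc k + σ S))
  Y = ∑⊆ m (λ S → hasGap (g (suc ∣ S ∣)) S ∧ Φ (suc ∣ S ∣) (g (suc ∣ S ∣) + suc k + σ S))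
  split : ∀ x y z → ((x ∧ true) xor y) ∧ z ≡ (x ∧ z) xor (y ∧ z)
  split = solve 3 (λ x y z → (x :* con true :+ y) :* z := x :* z :+ y :* z) refl
  drop : ∀ x y z → ((x ∧ false) xor y) ∧ z ≡ y ∧ z
  drop = solve 3 (λ x y z → (x :* con false :+ y) :* z := y :* z) refl
  in-true : ∀ S → (hasPart (f (suc ∣ S ∣)) (true ∷ S) ∧ Φ⁺ ∣ S ∣ (σ S)) ≡
    (H S xor (hasPart (g (suc ∣ S ∣)) S ∧ Φ⁺ ∣ S ∣ (σ S)))
  in-true S = trans (cong (_∧ Φ⁺ ∣ S ∣ (σ S)) (hasPart-∷ (f (suc ∣ S ∣)) true S)) (split (f (suc ∣ S ∣) ≡ᵇ 1) _ _)
  in-false : ∀ S → (hasPart (f ∣ S ∣) (false ∷ S) ∧ Φ ∣ S ∣ (σ S)) ≡ (hasPart (g ∣ S ∣) S ∧ Φ ∣ S ∣ (σ S))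
  in-false S = trans (cong (_∧ Φ ∣ S ∣ (σ S)) (hasPart-∷ (f ∣ S ∣) false S)) (drop (f ∣ S ∣ ≡ᵇ 1) _ _)
  gap-guard : ∀ p (S : Subset m) (Ψ : ℕ → Bool) w →
    hasGap (pred p) S ∧ Ψ (p + k + w) ≡ hasGap (pred p) S ∧ Ψ (pred p + suc k + w)
  -- For p = 0 the two arguments of Ψ differ, but `hasGap` at 0 annihilates both sides.
  gap-guard zero    S Ψ w = trans (cong (_∧ _) (hasGap-zero S)) (sym (cong (_∧ _) (hasGap-zero S)))
  gap-guard (suc p) S Ψ w = cong (λ i → hasGap p S ∧ Ψ (i + w)) (sym (+-suc p k))
  out-true : ∀ S → hasGap (f (suc (suc ∣ S ∣))) (true ∷ S)
      ∧ Φ (suc (suc ∣ S ∣)) (f (suc (suc ∣ S ∣)) + k + (suc k + σ S)) ≡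
    hasGap (g (suc (suc ∣ S ∣))) S ∧ Φ⁺ (suc ∣ S ∣) (g (suc (suc ∣ S ∣)) + suc k + σ S)
  out-true S = begin
    hasGap p (true ∷ S) ∧ Ψ (p + k + (suc k + σ S))          ≡⟨ drop (p ≡ᵇ 1) _ _ ⟩
    hasGap (pred p) S ∧ Ψ (p + k + (suc k + σ S))            ≡⟨ gap-guard p S Ψ (suc k + σ S) ⟩
    hasGap (pred p) S ∧ Ψ (pred p + suc k + (suc k + σ S))
      ≡⟨ cong (λ w → hasGap (pred p) S ∧ Ψ w) (swap (pred p + suc k) (suc k) (σ S)) ⟩
    hasGap (pred p) S ∧ Ψ (suc k + (pred p + suc k + σ S))   ∎
    where
    p = f (suc (suc ∣ S ∣))
    Ψ = Φ (suc (suc ∣ S ∣))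
    swap : ∀ x y z → x + (y + z) ≡ y + (x + z)
    swap = solve-∀
  out-false : ∀ S → hasGap (f (suc ∣ S ∣)) (false ∷ S) ∧ Φ (suc ∣ S ∣) (f (suc ∣ S ∣) + k + σ S) ≡
    H S xor (hasGap (g (suc ∣ S ∣)) S ∧ Φ (suc ∣ S ∣) (g (suc ∣ S ∣) + suc k + σ S))
  out-false S = trans (split (p ≡ᵇ 1) _ _) (cong₂ _xor_ (only-one p) (gap-guard p S Ψ (σ S)))
    where
    p = f (suc ∣ S ∣)
    Ψ = Φ (suc ∣ S ∣)
    only-one : ∀ p → (p ≡ᵇ 1) ∧ Ψ (p + k + σ S) ≡ (p ≡ᵇ 1) ∧ Ψ (suc k + σ S)
    only-one zero          = refl
    only-one (suc zero)    = refl
    only-one (suc (suc p)) = refl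

-- A weight of a per part replaces each part i by a + i, so the sum over subsets is the expanded
-- product of the factors 1 + q^(a+i).
∑⊆-∏ : ∀ m k a N → ∑⊆ m (λ S → ((a * ∣ S ∣ + partSumFrom k S) ▹ 𝟙) N) ≡ ∏ (a + k) m N
∑⊆-∏ zero    k a N = ▹-exp 𝟙 N (trans (+-identityʳ (a * 0)) (*-zeroʳ a))
∑⊆-∏ (suc m) k a N = begin
  ∑⊆ m (λ S → ((a * suc ∣ S ∣ + (suc k + σ S)) ▹ 𝟙) N) xor ∑⊆ m (λ S → ((a * ∣ S ∣ + σ S) ▹ 𝟙) N)
    ≡⟨ cong₂ _xor_ (∑⊆-cong m λ S → trans (▹-exp 𝟙 N (regroup a ∣ S ∣ k (σ S))) (sym (▹-▹ (suc (a + k)) _ 𝟙 N)))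
         (∑⊆-∏ m (suc k) a N) ⟩
  ∑⊆ m (λ S → (suc (a + k) ▹ (a * ∣ S ∣ + σ S) ▹ 𝟙) N) xor ∏ (a + suc k) m N
    ≡⟨ cong (_xor ∏ (a + suc k) m N) (∑⊆-▹ (suc (a + k)) m (λ S → (a * ∣ S ∣ + σ S) ▹ 𝟙) N) ⟨
  (suc (a + k) ▹ (λ M → ∑⊆ m (λ S → ((a * ∣ S ∣ + σ S) ▹ 𝟙) M))) N xor ∏ (a + suc k) m N
    ≡⟨ cong (_xor ∏ (a + suc k) m N) (▹-cong (suc (a + k)) (∑⊆-∏ m (suc k) a) N) ⟩
  (suc (a + k) ▹ ∏ (a + suc k) m) N xor ∏ (a + suc k) m N
    ≡⟨ cong (λ j → (suc (a + k) ▹ ∏ j m) N xor ∏ j m N) (+-suc a k) ⟩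
  (suc (a + k) ▹ ∏ (suc (a + k)) m) N xor ∏ (suc (a + k)) m N
    ≡⟨ xor-comm ((suc (a + k) ▹ ∏ (suc (a + k)) m) N) _ ⟩
  ∏ (a + k) (suc m) N ∎
  where
  σ : Subset m → ℕ
  σ = partSumFrom (suc k)
  regroup : ∀ a i k w → a * suc i + (suc k + w) ≡ suc (a + k) + (a * i + w)
  regroup = solve-∀

-- The recurrence for B(a) and its iteration

module NonRascoe (L : ℕ) where

  weight : ℕ → Subset L → ℕ
  weight a S = a * ∣ S ∣ + partSum S

  B : ℕ → Series
  B a N = ∑⊆ L (λ S → not (hasPart (a + ∣ S ∣) S) ∧ (weight a S ▹ 𝟙) N)

  -- With i parts left, the removed part a + i + 1 and its weight a contribute 2a + 1 + i, and this
  -- i raises the weight per part to a + 1. The removed size (a+1) + i is exactly what B(a+1)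
  -- forbids.
  removed : ∀ a {N} → N ≤ L → ∀ S →
    hasGap (a + suc ∣ S ∣) S ∧ ((a * suc ∣ S ∣ + (a + suc ∣ S ∣ + 0 + partSum S)) ▹ 𝟙) N ≡
    (suc (a + a) ▹ (λ M → not (hasPart (suc a + ∣ S ∣) S) ∧ (weight (suc a) S ▹ 𝟙) M)) N
  removed a {N} N≤L S = begin
    hasGap (a + suc i) S ∧ ((a * suc i + (a + suc i + 0 + w)) ▹ 𝟙) N
      ≡⟨ cong₂ (λ p e → hasGap p S ∧ (e ▹ 𝟙) N) (+-suc a i) (exp₁ a i w) ⟩
    hasGap (suc a + i) S ∧ ((suc (a + a) + weight (suc a) S) ▹ 𝟙) N
      ≡⟨ in-range ⟩
    not (hasPart (suc a + i) S) ∧ ((suc (a + a) + weight (suc a) S) ▹ 𝟙) N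
      ≡⟨ cong (not (hasPart (suc a + i) S) ∧_) (▹-▹ (suc (a + a)) (weight (suc a) S) 𝟙 N) ⟨
    not (hasPart (suc a + i) S) ∧ (suc (a + a) ▹ weight (suc a) S ▹ 𝟙) N
      ≡⟨ ∧-▹ (suc (a + a)) (weight (suc a) S ▹ 𝟙) (not (hasPart (suc a + i) S)) ⟩
    (suc (a + a) ▹ (λ M → not (hasPart (suc a + i) S) ∧ (weight (suc a) S ▹ 𝟙) M)) N ∎
    where
    i = ∣ S ∣
    w = partSum S
    exp₁ : ∀ a i w → a * suc i + (a + suc i + 0 + w) ≡ suc (a + a) + (suc a * i + w)
    exp₁ = solve-∀
    ∧-▹ : ∀ k f x → x ∧ (k ▹ f) N ≡ (k ▹ (λ M → x ∧ f M)) N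
    ∧-▹ k f true  = refl
    ∧-▹ k f false = sym (▹-𝟘 k N)
    in-range : hasGap (suc a + i) S ∧ ((suc (a + a) + weight (suc a) S) ▹ 𝟙) N ≡
      not (hasPart (suc a + i) S) ∧ ((suc (a + a) + weight (suc a) S) ▹ 𝟙) N
    in-range with <-≤-connex (a + i) L
    ... | inj₁ a+i<L = cong (_∧ ((suc (a + a) + weight (suc a) S) ▹ 𝟙) N) (hasGap≡not-hasPart (a + i) a+i<L S)
    -- Here the part exceeds L and `hasGap` may differ from the negated `hasPart`, but the exponent
    -- is greater than N and both sides vanish.
    ... | inj₂ L≤a+i = trans (trans (cong (hasGap (suc a + i) S ∧_) vanishes) (∧-zeroʳ _))
        (sym (trans (cong (not (hasPart (suc a + i) S) ∧_) vanishes) (∧-zeroʳ _)))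
      where
      vanishes : ((suc (a + a) + weight (suc a) S) ▹ 𝟙) N ≡ false
      vanishes = ▹-vanish 𝟙 (s≤s (≤-trans N≤L (≤-trans L≤a+i
        (+-mono-≤ (m≤m+n a a) (≤-trans (m≤m+n i (a * i)) (m≤m+n (suc a * i) w))))))

  B-rec : ∀ a N → N ≤ L → B a N ≡ ∏ a L N xor (suc (a + a) ▹ B (suc a)) N
  B-rec a N N≤L = begin
    ∑⊆ L (λ S → not (hasPart (a + ∣ S ∣) S) ∧ (weight a S ▹ 𝟙) N)
      ≡⟨ ∑⊆-cong L (λ S → complement (hasPart (a + ∣ S ∣) S) _) ⟩
    ∑⊆ L (λ S → (weight a S ▹ 𝟙) N xor (hasPart (a + ∣ S ∣) S ∧ (weight a S ▹ 𝟙) N))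
      ≡⟨ ∑⊆-xor L _ _ ⟩
    ∑⊆ L (λ S → (weight a S ▹ 𝟙) N) xor ∑⊆ L (λ S → hasPart (a + ∣ S ∣) S ∧ (weight a S ▹ 𝟙) N)
      ≡⟨ cong₂ _xor_ (trans (∑⊆-∏ L 0 a N) (cong (λ j → ∏ j L N) (+-identityʳ a)))
           (trans (remove-part L 0 (λ i → a + i) (λ i w → ((a * i + w) ▹ 𝟙) N))
             (trans (∑⊆-cong L (removed a N≤L)) (sym (∑⊆-▹ (suc (a + a)) L _ N)))) ⟩
    ∏ a L N xor (suc (a + a) ▹ B (suc a)) N ∎
    where
    complement : ∀ x y → not x ∧ y ≡ y xor (x ∧ y)
    complement true  y = sym (xor-same y)
    complement false y = sym (xor-identityʳ y)

  -- The shifts accumulate to 1 + 3 + ... + (2M - 1) = M².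
  B-unroll : ∀ M N → N ≤ L → B 0 N ≡ ∑ M (SumSide.term L 0) N xor ((M * M) ▹ B M) N
  B-unroll zero    N N≤L = refl
  B-unroll (suc M) N N≤L = begin
    B 0 N
      ≡⟨ B-unroll M N N≤L ⟩
    ∑ M t N xor ((M * M) ▹ B M) N
      ≡⟨ cong (∑ M t N xor_) (▹-cong≤ (M * M) N λ K le →
           B-rec M K (≤-trans (m≤n+m K (M * M)) (≤-trans le N≤L))) ⟩
    ∑ M t N xor ((M * M) ▹ (∏ M L ⊕ suc (M + M) ▹ B (suc M))) N
      ≡⟨ cong (∑ M t N xor_) (trans (▹-⊕ (M * M) (∏ M L) _ N)
           (cong₂ _xor_ (▹-exp (∏ M L) N (sym (+-identityʳ (M * M))))
             (trans (▹-▹ (M * M) (suc (M + M)) (B (suc M)) N) (▹-exp (B (suc M)) N (square M))))) ⟩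
    ∑ M t N xor (t M N xor ((suc M * suc M) ▹ B (suc M)) N)
      ≡⟨ xor-assoc (∑ M t N) (t M N) _ ⟨
    (∑ M t N xor t M N) xor ((suc M * suc M) ▹ B (suc M)) N
      ≡⟨ cong (_xor ((suc M * suc M) ▹ B (suc M)) N) (∑<-last M (λ n → t n N)) ⟨
    ∑ (suc M) t N xor ((suc M * suc M) ▹ B (suc M)) N ∎
    where
    t = SumSide.term L 0
    square : ∀ M → M * M + suc (M + M) ≡ suc M * suc M
    square = solve-∀

  B≡F : B 0 L ≡ SumSide.F L 0 L
  -- After L + 1 rounds the remaining shift (L+1)² exceeds L.
  B≡F = trans (B-unroll (suc L) L ≤-refl)
    (trans (cong (SumSide.F L 0 L xor_) (▹-vanish (B (suc L)) (m≤m*n (suc L) (suc L)))) (xor-identityʳ _))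

odd-b : ∀ n → odd (b n) ≡ PentagonalSide.R n 0 n
odd-b n = begin
  odd (b n)                 ≡⟨ odd-count n (IsNonRascoe n) ⟩
  ∑⊆ n (IsNonRascoe n)      ≡⟨ ∑⊆-cong n (λ S → trans (∧-comm (IsDistinctPartition n S) _)
                                 (cong (not (hasPart ∣ S ∣ S) ∧_) (≡ᵇ-monomial (partSum S) n))) ⟩
  -- For a = 0 the weight is just the sum of the parts; n serves both as the largest part allowed
  -- and as the precision.
  NonRascoe.B n 0 n         ≡⟨ NonRascoe.B≡F n ⟩
  SumSide.F n 0 n           ≡⟨ sum≡pentagonal n ⟩
  PentagonalSide.R n 0 n    ∎

theorem1p3 : (n : ℕ) →
    (b n % 2 ≡ 1) ⇔ (∃[ m ] (+ 2 ℤ.* + n ≡ m ℤ.* (+ 5 ℤ.* m ℤ.+ + 1)))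
theorem1p3 n = mk⇔
  (λ h → Equivalence.to (IsPent⇔ n) (Equivalence.to (pentagonal-coeff n)
     (trans (sym (odd-b n)) (Equivalence.to (odd⇔%2 (b n)) h))))
  (λ h → Equivalence.from (odd⇔%2 (b n)) (trans (odd-b n)
     (Equivalence.from (pentagonal-coeff n) (Equivalence.from (IsPent⇔ n) h))))
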